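{- Let $a,b,n\ge1$ be integers. The Horadam cube $\Pi^{a,b}_n$ contains a Hamiltonian path. If, moreover, $n>2$ and the number of vertices of $\Pi^{a,b}_n$ is even, then $\Pi^{a,b}_n$ is Hamiltonian.
   Context: For integers $a,b\ge1$ and $n\ge 0$, $\mathcal S^{a,b}_n$ is the set of all strings of length $n$ over the alphabet $\{0,1,\dots,a+b-1\}$ in which every letter from $\{a,\dots,a+b-1\}$ appears only immediately after a letter $0$. The Horadam cube $\Pi^{a,b}_n$ is the simple graph with vertex set $\mathcal S^{a,b}_n$ in which $x_1\cdots x_n$ and $y_1\cdots y_n$ are adjacent if and only if $\sum_{i=1}^n|x_i-y_i|=1$. A Hamiltonian path is a path visiting each vertex exactly once; a graph is Hamiltonian if it contains a cycle visiting each vertex exactly once. -}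

module Defs where

open import Data.Fin.Base using (Fin; toℕ)
open import Data.List.Base using (List; _∷_; _∷ʳ_; length)
open import Data.List.Membership.Propositional using (_∈_)
open import Data.List.Relation.Unary.Linked using (Linked)
open import Data.List.Relation.Unary.Unique.Propositional using (Unique)
open import Data.Nat.Base using (ℕ; suc; _+_; _≤_; ∣_-_∣)
open import Data.Nat.Properties using (∣-∣-comm; ∣n-n∣≡0)
open import Data.Product.Base using (_×_; ∃-syntax)
open import Data.Refinement.Base using (Refinement; value)
open import Data.Vec.Base using (Vec; []; _∷_; lookup; sum; zipWith)
open import Relation.Binary.Core using (Rel)
open import Relation.Binary.Definitions using (Symmetric; Irreflexive)
open import Relation.Binary.PropositionalEquality
  using (_≡_; refl; sym; trans; cong₂)
import Level

record SimpleGraph : Set₁ where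
  field
    Vertex : Set
    _~_    : Rel Vertex Level.zero
    ~-sym  : Symmetric _~_
    ~-irr  : Irreflexive _≡_ _~_

module _ (G : SimpleGraph) where
  open SimpleGraph G

  VisitsEachOnce : List Vertex → Set
  VisitsEachOnce vs = Unique vs × (∀ v → v ∈ vs)

  HasHamiltonianPath : Set
  HasHamiltonianPath =
    ∃[ v ] ∃[ vs ] Linked _~_ (v ∷ vs) × VisitsEachOnce (v ∷ vs)

  -- The cycle is listed without repeating its first vertex at the end.  The
  -- length bound rules out a single vertex and an edge traversed back and forth.
  IsHamiltonian : Set
  IsHamiltonian =
    ∃[ v ] ∃[ vs ] 3 ≤ length (v ∷ vs)
                 × Linked _~_ ((v ∷ vs) ∷ʳ v)
                 × VisitsEachOnce (v ∷ vs)

Admissible : ∀ a b {n} → Vec (Fin (a + b)) n → Set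
Admissible a b {n} s =
  ∀ (i : Fin n) → a ≤ toℕ (lookup s i) →
  ∃[ j ] suc (toℕ j) ≡ toℕ i × toℕ (lookup s j) ≡ 0

-- The proof of admissibility is irrelevant in a refinement type, so strings
-- are equal exactly when their letters are.
𝓢 : (a b n : ℕ) → Set
𝓢 a b n = Refinement (Vec (Fin (a + b)) n) (Admissible a b)

dist : ∀ {k n} → Vec (Fin k) n → Vec (Fin k) n → ℕ
dist xs ys = sum (zipWith (λ x y → ∣ toℕ x - toℕ y ∣) xs ys)

dist-comm : ∀ {k n} (xs ys : Vec (Fin k) n) → dist xs ys ≡ dist ys xs
dist-comm []       []       = refl
dist-comm (x ∷ xs) (y ∷ ys) =
  cong₂ _+_ (∣-∣-comm (toℕ x) (toℕ y)) (dist-comm xs ys)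

dist-refl : ∀ {k n} (xs : Vec (Fin k) n) → dist xs xs ≡ 0
dist-refl []       = refl
dist-refl (x ∷ xs) = cong₂ _+_ (∣n-n∣≡0 (toℕ x)) (dist-refl xs)

Π : (a b n : ℕ) → SimpleGraph
Π a b n = record
  { Vertex = 𝓢 a b n
  ; _~_    = λ x y → dist (value x) (value y) ≡ 1
  ; ~-sym  = λ {x} {y} x~y → trans (dist-comm (value y) (value x)) x~y
  ; ~-irr  = irr
  }
  where
  irr : Irreflexive _≡_ (λ (x y : 𝓢 a b n) → dist (value x) (value y) ≡ 1)
  irr {x} refl x~x with () ← trans (sym (dist-refl (value x))) x~x

{-# OPTIONS --safe #-}

-- Splitting off the first block, x with x < a or 0 x with x ≥ a, shows that Π_n
-- contains a copies of Π_{n-1} arranged in a path and b further copies of Π_{n-2},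
-- attached to the copy of Π_{n-2} behind 0 (a - 1) and arranged in a path as well.
--
-- Hamiltonian path: traverse the copies of Π_{n-1} back and forth so as to
-- arrive in the copy behind 0 at the start of its path; this start lies behind
-- 0 (a - 1), so the traversal continues through the copies of Π_{n-2}.  The path
-- obtained begins with a copy of Π_{n-1} behind a - 1, which is what the next
-- step needs.
--
-- Hamiltonian cycle: if |Π_n| is even, then |Π_k| and |Π_{n-k-1}| are even for
-- k = 1 or k = 2.  Π_k × Π_{n-k} has an even number of rows, hence contains a
-- Hamiltonian cycle that runs back and forth through the rows and returns along
-- their last column.  The remaining vertices are attached to a subpath with
-- |Π_{n-k-1}| vertices of some rows, and are inserted by detours from every
-- second edge of this subpath.

module Submission where

open import Defs
open import Data.Empty using (⊥-elim-irr)
open import Data.Fin.Base using (Fin; zero; suc; toℕ; fromℕ; splitAt; _↑ˡ_; _↑ʳ_)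
open import Data.Fin.Properties
  using (splitAt⁻¹-↑ˡ; splitAt⁻¹-↑ʳ; toℕ-↑ˡ; toℕ-↑ʳ; toℕ-fromℕ; toℕ<n; ↑ˡ-injective; ↑ʳ-injective)
open import Data.List.Base
  using ( List; []; _∷_; [_]; _++_; _∷ʳ_; map; reverse; length; concatMap
        ; cartesianProductWith; tabulate; allFin)
open import Data.List.Membership.Propositional using (_∈_)
open import Data.List.Membership.Propositional.Properties
  using ( ∈-map⁺; ∈-map⁻; ∈-++⁺ˡ; ∈-++⁺ʳ; ∈-++⁻; ∈-allFin
        ; ∈-cartesianProductWith⁺; ∈-cartesianProductWith⁻)
open import Data.List.Membership.Propositional.Properties.WithK using (unique∧set⇒bag)
open import Data.List.Properties
  using ( ++-assoc; ++-identityʳ; unfold-reverse; map-tabulate; map-++; map-∘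
        ; length-++; length-map; length-tabulate)
open import Data.List.Relation.Binary.BagAndSetEquality using (∼bag⇒↭)
open import Data.List.Relation.Binary.Permutation.Propositional
  using (_↭_; prep; ↭-refl; ↭-reflexive; ↭-sym; ↭-trans; ↭⇒↭ₛ; module PermutationReasoning)
open import Data.List.Relation.Binary.Permutation.Propositional.Properties
  using (∈-resp-↭; ↭-length; ↭-reverse; ++⁺; ++⁺ˡ; ++⁺ʳ; ++-comm; shift; shifts; ∷↭∷ʳ)
  renaming (map⁺ to ↭-map⁺)
import Data.List.Relation.Binary.Permutation.Setoid.Properties as ↭ₛ
open import Data.List.Relation.Unary.All using ([]; _∷_)
open import Data.List.Relation.Unary.AllPairs using ([]; _∷_)
open import Data.List.Relation.Unary.Any using (here; there)
open import Data.List.Relation.Unary.Linked using (Linked; [-]; _∷_)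
open import Data.List.Relation.Unary.Unique.Propositional using (Unique)
import Data.List.Relation.Unary.Unique.Propositional.Properties as Unique
open import Data.Nat.Base using (ℕ; zero; suc; _+_; _*_; _≤_; _<_; z≤n; s≤s; ∣_-_∣; parity)
open import Data.Nat.Divisibility using (_∣_; divides)
open import Data.Nat.Properties
  using ( ∣n-n∣≡0; ∣-∣-comm; ∣m+n-m+o∣≡∣n-o∣; +-assoc; ≤-trans; ≤-reflexive; m≤m+n; <⇒≱
        ; +-identityʳ; +-comm; +-mono-≤; suc-injective)
open import Data.Parity.Base as ℙ using (Parity; 0ℙ; 1ℙ)
open import Data.Parity.Properties using (+-homo-+; *-homo-*)
open import Data.Product.Base using (∃-syntax; _×_; _,_; swap; proj₁; proj₂)
open import Data.Refinement.Base using (value; _,_)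
open import Data.Refinement.Properties using (value-injective)
import Data.Irrelevant as Irr
open import Data.Sum.Base using (_⊎_; inj₁; inj₂)
open import Data.Vec.Properties using (∷-injectiveˡ; ∷-injectiveʳ)
open import Data.Vec.Base as Vec using (Vec; []; _∷_)
open import Function.Base using (_∘_; flip)
open import Function.Bundles using (_↔_; Inverse; Injection; mk⇔)
open import Function.Properties.Inverse using (↔⇒↣)
open import Level using (0ℓ)
open import Relation.Binary.Core using (Rel; _=[_]⇒_)
open import Relation.Binary.Definitions using (Symmetric)
open import Relation.Binary.PropositionalEquality
  using (_≡_; refl; sym; trans; cong; cong₂; subst; setoid; module ≡-Reasoning)
open import Relation.Nullary.Negation using (¬_; contradiction)

-- Paths with recorded ends, and back-and-forth traversals of products.

private
  variable
    A B C Q V : Set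

-- `Linked` hides the last vertex of a list. With both ends as indices, joining two paths takes just
-- one edge between known vertices.
data Path (_~_ : Rel A 0ℓ) : A → A → List A → Set where
  [-] : ∀ {x} → Path _~_ x x [ x ]
  _∷_ : ∀ {x y z ys} → x ~ y → Path _~_ y z ys → Path _~_ x z (x ∷ ys)

infixr 5 _∷_

module _ {_~_ : Rel A 0ℓ} where

  link : ∀ {u v x y xs ys} →
         Path _~_ u x xs → x ~ y → Path _~_ y v ys → Path _~_ u v (xs ++ ys)
  link [-]     x~y q = x~y ∷ q
  link (r ∷ p) x~y q = r ∷ link p x~y q

  glue : ∀ {u v x xs ys} →
         Path _~_ u x xs → Path _~_ x v (x ∷ ys) → Path _~_ u v (xs ++ ys)
  glue [-]     q = q
  glue (r ∷ p) q = r ∷ glue p q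

  Path-head : ∀ {u v xs} → Path _~_ u v xs → ∃[ ys ] xs ≡ u ∷ ys
  Path-head [-]     = _ , refl
  Path-head (_ ∷ _) = _ , refl

  Path⇒Linked : ∀ {u v xs} → Path _~_ u v xs → Linked _~_ xs
  Path⇒Linked [-]               = [-]
  Path⇒Linked (r ∷ [-])         = r ∷ [-]
  Path⇒Linked (r ∷ p@(_ ∷ _))   = r ∷ Path⇒Linked p

  -- The vertices of the second path move to the first one by one until only `v` is left. In
  -- `extend` this detaches the end of the Hamiltonian path, which later lies on the spine of the
  -- cycle.
  unsnoc : ∀ {u v x y xs ys} →
           Path _~_ u x (u ∷ xs) → x ~ y → Path _~_ y v ys →
           ∃[ w ] ∃[ zs ] Path _~_ u w (u ∷ zs) × w ~ v × xs ++ ys ≡ zs ∷ʳ v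
  unsnoc {xs = xs} p x~y [-] = _ , xs , p , x~y , refl
  unsnoc {y = y} {xs = xs} p x~y (y~z ∷ q)
    with w , zs , p′ , w~v , eq ← unsnoc (link p x~y [-]) y~z q
    = w , zs , p′ , w~v , trans (sym (++-assoc xs [ y ] _)) eq

  module _ (~-sym : Symmetric _~_) where

    Path-reverse : ∀ {u v xs} → Path _~_ u v xs → Path _~_ v u (reverse xs)
    Path-reverse [-] = [-]
    Path-reverse {u} {v} (_∷_ {ys = ys} r p) =
      subst (Path _~_ v u) (sym (unfold-reverse u ys))
            (link (Path-reverse p) (~-sym r) [-])

Path-map : {_~_ : Rel A 0ℓ} {_≈_ : Rel B 0ℓ} (f : A → B) → _~_ =[ f ]⇒ _≈_ →
           ∀ {u v xs} → Path _~_ u v xs → Path _≈_ (f u) (f v) (map f xs)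
Path-map f f⁺ [-]     = [-]
Path-map f f⁺ (r ∷ p) = f⁺ r ∷ Path-map f f⁺ p

-- Boustrophedon traversals of a product of two paths.
module _ {_≈_ : Rel Q 0ℓ} {_∼_ : Rel C 0ℓ} {_~_ : Rel V 0ℓ}
         (∼-sym : Symmetric _∼_) (f : Q → C → V)
         (f-congˡ : ∀ {q q′} c → q ≈ q′ → f q c ~ f q′ c)
         (f-congʳ : ∀ q {c c′} → c ∼ c′ → f q c ~ f q c′) where

  -- The construction works backwards from the last row, which has to end over `s`. The direction of
  -- the first row then depends on the parity of the number of rows, hence the existential `x`, `y`
  -- and `ds`. The first row is kept apart from `rest` because `extend` needs it as the next prefix.
  ladder : ∀ {q q′ s t qs cs} → Path _≈_ q q′ qs → Path _∼_ s t cs →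
    ∃[ x ] ∃[ y ] ∃[ ds ] ∃[ rest ]
      Path _∼_ x y ds × ds ↭ cs ×
      Path _~_ (f q y) (f q′ s) (f q y ∷ rest) ×
      map (f q) ds ++ rest ↭ cartesianProductWith f qs cs
  ladder {q} {cs = cs} [-] p =
    _ , _ , reverse cs , [] , Path-reverse ∼-sym p , ↭-reverse cs , [-] ,
    ++⁺ʳ [] (↭-map⁺ (f q) (↭-reverse cs))
  ladder {q} (_∷_ {y = q₂} r ps) p
    with x , y , ds , rest , d , ds↭ , tail , perm ← ladder ps p
    = y , x , reverse ds , map (f q₂) ds ++ rest ,
      Path-reverse ∼-sym d , ↭-trans (↭-reverse ds) ds↭ ,
      f-congˡ x r ∷ glue (Path-map (f q₂) (f-congʳ q₂) d) tail ,
      ++⁺ (↭-map⁺ (f q) (↭-trans (↭-reverse ds) ds↭)) perm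

  -- Rows are taken in pairs, out along the first and back along the second, so that each pair
  -- starts and ends over `s`.
  evenLadder : ∀ {q q′ s t qs cs} → Path _≈_ q q′ qs → parity (length qs) ≡ 0ℙ →
    Path _∼_ s t cs →
    ∃[ vs ] Path _~_ (f q s) (f q′ s) vs × vs ↭ cartesianProductWith f qs cs
  evenLadder {q} {q′} {cs = cs} (r ∷ [-]) even p =
    map (f q) cs ++ map (f q′) (reverse cs) ,
    link (Path-map (f q) (f-congʳ q) p) (f-congˡ _ r)
         (Path-map (f q′) (f-congʳ q′) (Path-reverse ∼-sym p)) ,
    ++⁺ˡ (map (f q) cs)
         (↭-trans (↭-map⁺ (f q′) (↭-reverse cs))
                  (↭-reflexive (sym (++-identityʳ _))))
  evenLadder {q} {cs = cs} (_∷_ {y = q₂} r (r₂ ∷ ps)) even p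
    with vs , path , perm ← evenLadder ps even p
    = map (f q) cs ++ map (f q₂) (reverse cs) ++ vs ,
      link (Path-map (f q) (f-congʳ q) p) (f-congˡ _ r)
        (link (Path-map (f q₂) (f-congʳ q₂) (Path-reverse ∼-sym p)) (f-congˡ _ r₂) path) ,
      ++⁺ˡ (map (f q) cs) (++⁺ (↭-map⁺ (f q₂) (↭-reverse cs)) perm)

-- Every row q is a path from s q to t q followed by a vertex z q of the spine;
-- the rows are traversed back and forth, and the spine leads back to the start.
module _ {_≈_ : Rel Q 0ℓ} {_~_ : Rel V 0ℓ} (~-sym : Symmetric _~_)
         (s t z : Q → V) (row : Q → List V)
         (s⁺ : _≈_ =[ s ]⇒ _~_) (t⁺ : _≈_ =[ t ]⇒ _~_) (z⁺ : _≈_ =[ z ]⇒ _~_)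
         (t~z : ∀ q → t q ~ z q)
         (row-path : ∀ q → Path _~_ (s q) (t q) (row q)) where

  private
    rearrange : ∀ p q vs → reverse (row p) ++ row q ++ vs ++ z q ∷ z p ∷ [] ↭
                (z p ∷ row p) ++ (z q ∷ row q) ++ vs
    rearrange p q vs = begin
      reverse (row p) ++ row q ++ vs ++ z q ∷ z p ∷ []
        ↭⟨ ++⁺ (↭-reverse (row p)) (++⁺ˡ (row q) (++-comm vs _)) ⟩
      row p ++ row q ++ z q ∷ z p ∷ vs
        ↭⟨ ++⁺ˡ (row p) (shift (z q) (row q) _) ⟩
      row p ++ z q ∷ row q ++ z p ∷ vs
        ↭⟨ ++⁺ˡ (row p) (shift (z p) (z q ∷ row q) vs) ⟩
      row p ++ z p ∷ z q ∷ row q ++ vs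
        ↭⟨ shift (z p) (row p) _ ⟩
      z p ∷ row p ++ z q ∷ row q ++ vs ∎
      where open PermutationReasoning

  comb : ∀ {q q′ qs} → Path _≈_ q q′ qs → parity (length qs) ≡ 0ℙ →
    ∃[ vs ] Path _~_ (t q) (z q) vs × vs ↭ concatMap (λ q → z q ∷ row q) qs
  comb {q} {q′} (r ∷ [-]) even =
    reverse (row q) ++ row q′ ++ z q′ ∷ z q ∷ [] ,
    link (Path-reverse ~-sym (row-path q)) (s⁺ r)
      (link (row-path q′) (t~z q′) (~-sym (z⁺ r) ∷ [-])) ,
    rearrange q q′ []
  -- Two rows, one backwards and one forwards, lead from a `t` end to a `t` end. The path for the
  -- remaining rows starts at `t` and ends at `z`, so it fits between these two rows and their spine
  -- vertices.
  comb {q} (_∷_ {y = q₂} r (r₂ ∷ ps)) even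
    with vs , path , perm ← comb ps even
    = reverse (row q) ++ row q₂ ++ vs ++ z q₂ ∷ z q ∷ [] ,
      link (Path-reverse ~-sym (row-path q)) (s⁺ r)
        (link (row-path q₂) (t⁺ r₂)
          (link path (~-sym (z⁺ r₂)) (~-sym (z⁺ r) ∷ [-]))) ,
      ↭-trans (rearrange q q₂ vs)
              (++⁺ˡ (z q ∷ row q) (++⁺ˡ (z q₂ ∷ row q₂) perm))

-- Lists that contain every element exactly once.

Unique-resp-↭ : {xs ys : List A} → xs ↭ ys → Unique xs → Unique ys
Unique-resp-↭ xs↭ys = ↭ₛ.Unique-resp-↭ (setoid _) (↭⇒↭ₛ xs↭ys)

Enumerates : List A → Set
Enumerates xs = Unique xs × (∀ x → x ∈ xs)

Enumerates-resp-↭ : {xs ys : List A} → xs ↭ ys → Enumerates xs → Enumerates ys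
Enumerates-resp-↭ xs↭ys (unique , complete) =
  Unique-resp-↭ xs↭ys unique , λ x → ∈-resp-↭ xs↭ys (complete x)

Enumerates-length : {xs ys : List A} → Enumerates xs → Enumerates ys → length xs ≡ length ys
Enumerates-length (uxs , cxs) (uys , cys) =
  ↭-length (∼bag⇒↭ (unique∧set⇒bag uxs uys (mk⇔ (λ _ → cys _) (λ _ → cxs _))))

Enumerates-map : {f : A → B} → (∀ {x y} → f x ≡ f y → x ≡ y) → (∀ y → ∃[ x ] f x ≡ y) →
                 ∀ {xs} → Enumerates xs → Enumerates (map f xs)
Enumerates-map {f = f} injective surjective {xs} (unique , complete) =
  Unique.map⁺ injective unique ,
  λ y → let x , fx≡y = surjective y in subst (_∈ map f xs) fx≡y (∈-map⁺ f (complete x))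

length-cartesianProductWith : (f : A → B → C) → ∀ xs ys →
  length (cartesianProductWith f xs ys) ≡ length xs * length ys
length-cartesianProductWith f []       ys = refl
length-cartesianProductWith f (x ∷ xs) ys =
  trans (length-++ (map (f x) ys))
        (cong₂ _+_ (length-map (f x) ys) (length-cartesianProductWith f xs ys))

cartesianProductWith-∷ʳ : (f : A → B → C) → ∀ xs y ys →
  cartesianProductWith f xs (y ∷ ys) ↭ map (flip f y) xs ++ cartesianProductWith f xs ys
cartesianProductWith-∷ʳ f []       y ys = ↭-refl
cartesianProductWith-∷ʳ f (x ∷ xs) y ys = prep (f x y)
  (↭-trans (++⁺ˡ (map (f x) ys) (cartesianProductWith-∷ʳ f xs y ys))
           (shifts (map (f x) ys) (map (flip f y) xs)))

cartesianProductWith-mapʳ : (f : A → B → C) (g : Q → B) → ∀ xs ys →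
  cartesianProductWith f xs (map g ys) ≡ cartesianProductWith (λ x → f x ∘ g) xs ys
cartesianProductWith-mapʳ f g []       ys = refl
cartesianProductWith-mapʳ f g (x ∷ xs) ys =
  cong₂ _++_ (sym (map-∘ ys)) (cartesianProductWith-mapʳ f g xs ys)

module _ {rows : Q → List V} {π : V → Q}
         (rows-unique : ∀ q → Unique (rows q))
         (π-rows : ∀ q {v} → v ∈ rows q → π v ≡ q)
         (∈-rows : ∀ v → v ∈ rows (π v)) where

  private
    ∈-concatMap⁻ : ∀ qs {v} → v ∈ concatMap rows qs → π v ∈ qs
    ∈-concatMap⁻ (q ∷ qs) v∈ with ∈-++⁻ (rows q) v∈
    ... | inj₁ v∈q  = here (π-rows q v∈q)
    ... | inj₂ v∈qs = there (∈-concatMap⁻ qs v∈qs)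

    ∈-concatMap⁺ : ∀ {qs v} → π v ∈ qs → v ∈ concatMap rows qs
    ∈-concatMap⁺ {v = v} (here refl) = ∈-++⁺ˡ (∈-rows v)
    ∈-concatMap⁺ {qs = q ∷ _} (there v∈) = ∈-++⁺ʳ (rows q) (∈-concatMap⁺ v∈)

    unique : ∀ {qs} → Unique qs → Unique (concatMap rows qs)
    unique []                      = []
    unique {q ∷ qs} u@(_ ∷ u′) =
      Unique.++⁺ (rows-unique q) (unique u′)
        λ (v∈q , v∈qs) → Unique.Unique[x∷xs]⇒x∉xs u
          (subst (_∈ qs) (π-rows q v∈q) (∈-concatMap⁻ qs v∈qs))

  -- The rows are the fibres of `π`: by `π-rows` they are disjoint, and by `∈-rows` they cover `V`.
  Enumerates-concatMap : ∀ {qs} → Enumerates qs → Enumerates (concatMap rows qs)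
  Enumerates-concatMap (u , complete) = unique u , λ v → ∈-concatMap⁺ (complete (π v))

-- Paths of letters, and passage to the graph-theoretic definitions.

record _≈_ {k} (i j : Fin k) : Set where
  constructor consecutive
  field ∣i-j∣≡1 : ∣ toℕ i - toℕ j ∣ ≡ 1

allFin-path : ∀ n → Path _≈_ zero (fromℕ n) (allFin (suc n))
allFin-path zero    = [-]
allFin-path (suc n) = consecutive refl ∷
  subst (Path _≈_ _ _) (map-tabulate (λ i → i) suc)
    (Path-map suc (λ (consecutive eq) → consecutive eq) (allFin-path n))

≈-sym : ∀ {k} → Symmetric (_≈_ {k})
≈-sym {x = i} {y = j} (consecutive eq) = consecutive (trans (∣-∣-comm (toℕ j) (toℕ i)) eq)

reverse-allFin-path : ∀ n → Path _≈_ (fromℕ n) zero (reverse (allFin (suc n)))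
reverse-allFin-path n = Path-reverse ≈-sym (allFin-path n)

Enumerates-allFin : ∀ n → Enumerates (allFin n)
Enumerates-allFin n = Unique.allFin⁺ n , ∈-allFin

Enumerates-reverse-allFin : ∀ n → Enumerates (reverse (allFin n))
Enumerates-reverse-allFin n =
  Enumerates-resp-↭ (↭-sym (↭-reverse (allFin n))) (Enumerates-allFin n)

dist-++ : ∀ {k m n} (us vs : Vec (Fin k) m) (xs ys : Vec (Fin k) n) →
          dist (us Vec.++ xs) (vs Vec.++ ys) ≡ dist us vs + dist xs ys
dist-++ []       []       xs ys = refl
dist-++ (u ∷ us) (v ∷ vs) xs ys =
  trans (cong (∣ toℕ u - toℕ v ∣ +_) (dist-++ us vs xs ys))
        (sym (+-assoc ∣ toℕ u - toℕ v ∣ _ _))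

Path⇒HasHamiltonianPath : ∀ G {u v vs} → Path (SimpleGraph._~_ G) u v vs →
  Enumerates vs → HasHamiltonianPath G
Path⇒HasHamiltonianPath G p e with _ , refl ← Path-head p = _ , _ , Path⇒Linked p , e

Path⇒IsHamiltonian : ∀ G {u v vs} → Path (SimpleGraph._~_ G) u v vs → SimpleGraph._~_ G u v →
  Enumerates vs → 3 ≤ length vs → IsHamiltonian G
Path⇒IsHamiltonian G p u~v e 3≤ with _ , refl ← Path-head p =
  _ , _ , 3≤ , Path⇒Linked (link p (SimpleGraph.~-sym G u~v) [-]) , e

-- The Horadam recurrence modulo two.

horadamℙ : Parity → Parity → ℕ → Parity
horadamℙ p q zero          = 1ℙ
horadamℙ p q (suc zero)    = p
horadamℙ p q (suc (suc n)) = (p ℙ.* horadamℙ p q (suc n)) ℙ.+ (q ℙ.* horadamℙ p q n)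

horadamℙ-1-0 : ∀ n → horadamℙ 1ℙ 0ℙ n ≡ 1ℙ
horadamℙ-1-0 zero          = refl
horadamℙ-1-0 (suc zero)    = refl
horadamℙ-1-0 (suc (suc n)) = cong (ℙ._+ 0ℙ) (horadamℙ-1-0 (suc n))

-- If `p` is even, the first value is even and the recurrence reduces to its `q` term. If only `q`
-- is even, all values are odd. If both are odd, this is the Fibonacci recurrence, which has period
-- three modulo two.
horadamℙ-even : ∀ p q n → horadamℙ p q (3 + n) ≡ 0ℙ →
  (horadamℙ p q 1 ≡ 0ℙ × horadamℙ p q (1 + n) ≡ 0ℙ) ⊎
  (horadamℙ p q 2 ≡ 0ℙ × horadamℙ p q n ≡ 0ℙ)
horadamℙ-even 0ℙ 0ℙ zero    _    = inj₁ (refl , refl)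
horadamℙ-even 0ℙ 0ℙ (suc n) _    = inj₁ (refl , refl)
horadamℙ-even 0ℙ 1ℙ n       even = inj₁ (refl , even)
horadamℙ-even 1ℙ 0ℙ n       even with () ← trans (sym (horadamℙ-1-0 (3 + n))) even
horadamℙ-even 1ℙ 1ℙ n       even =
  inj₂ (refl , trans (sym (x+y+x≡y (horadamℙ 1ℙ 1ℙ (1 + n)) _)) even)
  where
  x+y+x≡y : ∀ x y → x ℙ.+ y ℙ.+ x ≡ y
  x+y+x≡y 0ℙ 0ℙ = refl
  x+y+x≡y 0ℙ 1ℙ = refl
  x+y+x≡y 1ℙ 0ℙ = refl
  x+y+x≡y 1ℙ 1ℙ = refl

2∣⇒parity≡0ℙ : ∀ {m} → 2 ∣ m → parity m ≡ 0ℙ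
2∣⇒parity≡0ℙ (divides zero    refl) = refl
2∣⇒parity≡0ℙ (divides (suc q) refl) = 2∣⇒parity≡0ℙ (divides q refl)

-- Block decomposition of strings, and adjacency of words.

module Horadam (a′ b′ : ℕ) where

  a b : ℕ
  a = suc a′
  b = suc b′

  lastˡ : Fin a
  lastˡ = fromℕ a′

  -- Admissible strings split uniquely into blocks: single letters i < a, and
  -- pairs 0, a + j with j < b.
  data Word : ℕ → Set where
    ε    : Word 0
    low  : ∀ {n} → Fin a → Word n → Word (suc n)
    high : ∀ {n} → Fin b → Word n → Word (suc (suc n))

  letters : ∀ {n} → Word n → Vec (Fin (a + b)) n
  letters ε          = []
  letters (low i w)  = (i ↑ˡ b) ∷ letters w
  letters (high j w) = zero ∷ (a ↑ʳ j) ∷ letters w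

  -- As with `_≈_`, a record instead of the bare equation allows `u` and `v` to be inferred from a
  -- proof of adjacency.
  record _~_ {n} (u v : Word n) : Set where
    constructor adjacent
    field dist≡1 : dist (letters u) (letters v) ≡ 1

  infix 4 _~_

  ~-sym : ∀ {n} → Symmetric (_~_ {n})
  ~-sym {x = u} {y = v} (adjacent eq) = adjacent (trans (dist-comm (letters v) (letters u)) eq)

  low-congʳ : ∀ i {n} {u v : Word n} → u ~ v → low i u ~ low i v
  low-congʳ i (adjacent eq) = adjacent (cong₂ _+_ (∣n-n∣≡0 (toℕ (i ↑ˡ b))) eq)

  high-congʳ : ∀ j {n} {u v : Word n} → u ~ v → high j u ~ high j v
  high-congʳ j (adjacent eq) = adjacent (cong₂ _+_ (∣n-n∣≡0 (toℕ (a ↑ʳ j))) eq)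

  low-congˡ : ∀ {i j n} (w : Word n) → i ≈ j → low i w ~ low j w
  low-congˡ {i} {j} w (consecutive eq) = adjacent (cong₂ _+_
    (trans (cong₂ ∣_-_∣ (toℕ-↑ˡ i b) (toℕ-↑ˡ j b)) eq) (dist-refl (letters w)))

  high-congˡ : ∀ {i j n} (w : Word n) → i ≈ j → high i w ~ high j w
  high-congˡ {i} {j} w (consecutive eq) = adjacent (cong₂ _+_
    (trans (cong₂ ∣_-_∣ (toℕ-↑ʳ a i) (toℕ-↑ʳ a j)) (trans (∣m+n-m+o∣≡∣n-o∣ a (toℕ i) (toℕ j)) eq))
    (dist-refl (letters w)))

  -- Only the second letters differ, and they are a - 1 and a. This edge attaches the words that
  -- begin with a `high` block to the others.
  low-high : ∀ {n} (w : Word n) → low zero (low lastˡ w) ~ high zero w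
  low-high w = adjacent (cong₂ _+_
    (trans (cong₂ ∣_-_∣ (trans (toℕ-↑ˡ lastˡ b) (toℕ-fromℕ a′))
                        (trans (toℕ-↑ʳ a (zero {b′})) (+-identityʳ a)))
           (∣n-1+n∣≡1 a′))
    (dist-refl (letters w)))
    where
    ∣n-1+n∣≡1 : ∀ n → ∣ n - suc n ∣ ≡ 1
    ∣n-1+n∣≡1 zero    = refl
    ∣n-1+n∣≡1 (suc n) = ∣n-1+n∣≡1 n

  low-injective : ∀ {i j n} {u v : Word n} → low i u ≡ low j v → i ≡ j × u ≡ v
  low-injective refl = refl , refl

  high-injective : ∀ {i j n} {u v : Word n} → high i u ≡ high j v → i ≡ j × u ≡ v
  high-injective refl = refl , refl

  Enumerates-suc-suc : ∀ {is js n} {us : List (Word (suc n))} {vs : List (Word n)} →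
    Enumerates is → Enumerates js → Enumerates us → Enumerates vs →
    Enumerates (cartesianProductWith low is us ++ cartesianProductWith high js vs)
  Enumerates-suc-suc {is} {js} {us = us} {vs} (ui , ci) (uj , cj) (uu , cu) (uv , cv) =
    Unique.++⁺ (Unique.cartesianProductWith⁺ low low-injective ui uu)
               (Unique.cartesianProductWith⁺ high high-injective uj uv) disjoint ,
    complete
    where
    disjoint : ∀ {w} → ¬ (w ∈ cartesianProductWith low is us ×
                          w ∈ cartesianProductWith high js vs)
    disjoint (w∈ , w∈′)
      with _ , _ , _ , _ , refl ← ∈-cartesianProductWith⁻ low is us w∈
      with _ , _ , _ , _ , () ← ∈-cartesianProductWith⁻ high js vs w∈′
    complete : ∀ w → w ∈ cartesianProductWith low is us ++ cartesianProductWith high js vs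
    complete (low i w)  = ∈-++⁺ˡ (∈-cartesianProductWith⁺ low (ci i) (cu w))
    complete (high j w) = ∈-++⁺ʳ _ (∈-cartesianProductWith⁺ high (cj j) (cv w))

  -- Hamiltonian paths.

  record Prefix (n : ℕ) : Set where
    field
      {start end} : Word n
      {words}     : List (Word n)
      path        : Path _~_ start end words
      enumerates  : Enumerates words

  -- A Hamiltonian path of Π_{n+1} that starts by traversing the copy of Π_n
  -- behind the letter a - 1: the strengthening that makes the induction work.
  record HamPath (n : ℕ) : Set where
    field
      prefix     : Prefix n
    open Prefix prefix public
    field
      {final}     : Word (suc n)
      {rest}      : List (Word (suc n))
      suffix      : Path _~_ (low lastˡ end) final (low lastˡ end ∷ rest)
      enumerates⁺ : Enumerates (map (low lastˡ) words ++ rest)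

    path⁺ : Path _~_ (low lastˡ start) final (map (low lastˡ) words ++ rest)
    path⁺ = glue (Path-map (low lastˡ) (low-congʳ lastˡ) path) suffix

  -- The same with the last vertex split off; it belongs to the spine of the cycle.
  record HamPath⁻ (n : ℕ) : Set where
    field
      prefix     : Prefix n
    open Prefix prefix public
    field
      {penult final} : Word (suc n)
      {rest}         : List (Word (suc n))
      suffix         : Path _~_ (low lastˡ end) penult (low lastˡ end ∷ rest)
      penult~final   : penult ~ final
      enumerates⁺    : Enumerates (final ∷ map (low lastˡ) words ++ rest)

    path⁻ : Path _~_ (low lastˡ start) penult (map (low lastˡ) words ++ rest)
    path⁻ = glue (Path-map (low lastˡ) (low-congʳ lastˡ) path) suffix

  complete-path : ∀ {n} → HamPath⁻ n → HamPath n
  complete-path h = record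
    { prefix      = prefix
    ; suffix      = link suffix penult~final [-]
    ; enumerates⁺ = Enumerates-resp-↭
        (↭-trans (∷↭∷ʳ final _) (↭-reflexive (++-assoc (map (low lastˡ) words) rest _)))
        enumerates⁺
    } where open HamPath⁻ h

  -- One induction hypothesis serves both kinds of copies: the longer words follow the whole path of
  -- `h`, the shorter ones its prefix. The copy behind a - 1 is traversed first and supplies the new
  -- prefix.
  extend : ∀ {n} → HamPath n → HamPath⁻ (suc n)
  extend {n} h
    with x , y , us , restˡ , p , us↭ , tailˡ , permˡ
           ← ladder ~-sym low low-congˡ (λ i → low-congʳ i)
               (reverse-allFin-path a′) (HamPath.path⁺ h)
    with x′ , y′ , vs , restʰ , q , vs↭ , tailʰ , permʰ
           ← ladder ~-sym high high-congˡ (λ j → high-congʳ j)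
               (reverse-allFin-path b′) (HamPath.path h)
    -- The first traversal ends at 0 (a - 1) followed by `start`, the second at 0 a followed by
    -- `start`. Hence the second is reversed and joined by `low-high`.
    with w , zs , r , w~v , eq
           ← unsnoc tailˡ (low-high (HamPath.start h))
               (Path-reverse ~-sym
                 (glue (Path-map (high (fromℕ b′)) (high-congʳ (fromℕ b′)) q) tailʰ))
    = record
    { prefix       = record { path = p ; enumerates = Enumerates-resp-↭ (↭-sym us↭) enumerates⁺ }
    ; suffix       = r
    ; penult~final = w~v
    ; enumerates⁺  = Enumerates-resp-↭ (↭-sym perm)
        (Enumerates-suc-suc (Enumerates-reverse-allFin a) (Enumerates-reverse-allFin b)
          enumerates⁺ enumerates)
    }
    where
    open HamPath h
    open PermutationReasoning
    ms = map (low lastˡ) us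
    hs = map (high (fromℕ b′)) vs ++ restʰ
    perm = begin
      _ ∷ ms ++ zs                     ↭⟨ ∷↭∷ʳ _ (ms ++ zs) ⟩
      (ms ++ zs) ∷ʳ _                  ≡⟨ ++-assoc ms zs _ ⟩
      ms ++ zs ∷ʳ _                    ≡⟨ cong (ms ++_) eq ⟨
      ms ++ restˡ ++ reverse hs        ≡⟨ ++-assoc ms restˡ _ ⟨
      (ms ++ restˡ) ++ reverse hs      ↭⟨ ++⁺ permˡ (↭-trans (↭-reverse hs) permʰ) ⟩
      _                                ∎

  hamPath : ∀ n → HamPath n
  hamPath (suc n) = complete-path (extend (hamPath n))
  hamPath zero
    with is , eq ← Path-head (reverse-allFin-path a′)
    = record
    { prefix      = record { path = [-] ; enumerates = [] ∷ [] , λ { ε → here refl } }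
    -- The letters are listed downwards from a - 1, and `eq` exposes this first letter, behind which
    -- the prefix consists of the empty word.
    ; suffix      = subst (Path _~_ _ _) (cong (map (λ i → low i ε)) eq)
        (Path-map (λ i → low i ε) (low-congˡ ε) (reverse-allFin-path a′))
    ; enumerates⁺ = subst (Enumerates ∘ map (λ i → low i ε)) eq
        (Enumerates-map (proj₁ ∘ low-injective) (λ { (low i ε) → i , refl })
          (Enumerates-reverse-allFin a))
    }

  -- Concatenating and cutting words.

  append : ∀ {m n} → Word m → Word n → Word (m + n)
  append ε          v = v
  append (low i u)  v = low i (append u v)
  append (high j u) v = high j (append u v)

  letters-append : ∀ {m n} (u : Word m) (v : Word n) →
                   letters (append u v) ≡ letters u Vec.++ letters v
  letters-append ε          v = refl
  letters-append (low i u)  v = cong (_ ∷_) (letters-append u v)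
  letters-append (high j u) v = cong (λ xs → _ ∷ _ ∷ xs) (letters-append u v)

  append-congˡ : ∀ {m n} {u u′ : Word m} (v : Word n) → u ~ u′ → append u v ~ append u′ v
  append-congˡ {u = u} {u′} v (adjacent eq) = adjacent
    (trans (cong₂ dist (letters-append u v) (letters-append u′ v))
      (trans (dist-++ (letters u) (letters u′) (letters v) (letters v))
        (cong₂ _+_ eq (dist-refl (letters v)))))

  append-congʳ : ∀ {m n} (u : Word m) {v v′ : Word n} → v ~ v′ → append u v ~ append u v′
  append-congʳ ε          v~v′ = v~v′
  append-congʳ (low i u)  v~v′ = low-congʳ i (append-congʳ u v~v′)
  append-congʳ (high j u) v~v′ = high-congʳ j (append-congʳ u v~v′)

  -- A block high j straddling position m is cut into its letter 0.
  take : ∀ m {n} → Word (m + n) → Word m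
  take zero          w          = ε
  take (suc zero)    (low i w)  = low i ε
  take (suc zero)    (high j w) = low zero ε
  take (suc (suc m)) (low i w)  = low i (take (suc m) w)
  take (suc (suc m)) (high j w) = high j (take m w)

  -- A path whose second letter runs from a - 1 up to a + b - 1. Entry `zero` lies on the row that
  -- the detour leaves, the others are the vertices to be inserted.
  column : ∀ {n} → Word n → Fin (suc b) → Word (suc (suc n))
  column w zero    = low zero (low lastˡ w)
  column w (suc j) = high j w

  column-congˡ : ∀ {n} {u v : Word n} i → u ~ v → column u i ~ column v i
  column-congˡ zero    u~v = low-congʳ zero (low-congʳ lastˡ u~v)
  column-congˡ (suc j) u~v = high-congʳ j u~v

  column-congʳ : ∀ {n} (w : Word n) {i j} → i ≈ j → column w i ~ column w j
  column-congʳ w {zero}        {suc zero}    _                = low-high w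
  column-congʳ w {suc zero}    {zero}        _                = ~-sym (low-high w)
  column-congʳ w {suc i}       {suc j}       (consecutive eq) = high-congˡ w (consecutive eq)
  column-congʳ w {zero}        {zero}        (consecutive ())
  column-congʳ w {zero}        {suc (suc _)} (consecutive ())
  column-congʳ w {suc (suc _)} {zero}        (consecutive ())

  -- Hamiltonian cycles from rows with detours.

  record HamCycle (n : ℕ) : Set where
    field
      {start end} : Word n
      {words}     : List (Word n)
      path        : Path _~_ start end words
      start~end   : start ~ end
      enumerates  : Enumerates words

  -- Π_{k+m+1} consists of a copy of Π_{m+1} behind every word u of length k and,
  -- if u ends in a block 0, of the strings u x w with x ≥ a and w in Π_m.  The
  -- latter are visited by detours from the Hamiltonian path of the copy, each
  -- one exploring the columns of two consecutive words of Π_m.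
  module Rows {m} (h : HamPath⁻ m) (even : parity (length (HamPath⁻.words h)) ≡ 0ℙ) where
    open HamPath⁻ h

    -- Of two consecutive words, the column of the first is climbed and that of the second
    -- descended. The ends agree with those of the prefix behind 0 (a - 1), so the result can
    -- replace that subpath.
    detours : ∃[ vs ]
      Path _~_ (low zero (low lastˡ start)) (low zero (low lastˡ end)) vs ×
      vs ↭ cartesianProductWith column words (allFin (suc b))
    detours = evenLadder ≈-sym column column-congˡ column-congʳ path even (allFin-path b)

    row₀ : List (Word (suc m))
    row₀ = map (low lastˡ) words ++ rest

    row₁ : Fin a → List (Word (suc (suc m)))
    row₁ zero    = proj₁ detours ++ map (low zero) rest
    row₁ (suc i) = map (low (suc i)) row₀

    -- Only the last block matters. If it is the letter 0, the recursion reaches `row₁ zero` and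
    -- detours are inserted; a word that is empty or ends in a `high` block reaches `ε` and gets the
    -- plain `row₀`.
    row : ∀ {k} → Word k → List (Word (k + suc m))
    row {zero}        ε          = row₀
    row {suc zero}    (low i ε)  = row₁ i
    row {suc (suc k)} (low i u)  = map (low i) (row u)
    row {suc (suc k)} (high j u) = map (high j) (row u)

    spine : ∀ {k} → Word k → Word (k + suc m)
    spine u = append u final

    row-path : ∀ {k} (u : Word k) →
      Path _~_ (append u (low lastˡ start)) (append u penult) (row u)
    row-path {zero} ε = path⁻
    row-path {suc zero} (low zero ε) =
      glue (proj₁ (proj₂ detours)) (Path-map (low zero) (low-congʳ zero) suffix)
    row-path {suc zero} (low (suc i) ε) = Path-map (low (suc i)) (low-congʳ (suc i)) path⁻
    row-path {suc (suc k)} (low i u)  = Path-map (low i) (low-congʳ i) (row-path u)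
    row-path {suc (suc k)} (high j u) = Path-map (high j) (high-congʳ j) (row-path u)

    -- The `zero` entries of the columns are exactly the vertices of the replaced subpath. Taking
    -- them out restores the plain row, and what remains are the words with a `high` block.
    zero-row-↭ : low zero final ∷ row₁ zero ↭
                 map (low zero) (final ∷ row₀) ++ cartesianProductWith (flip high) words (allFin b)
    zero-row-↭ = prep (low zero final) (begin
      proj₁ detours ++ zs
        ↭⟨ ++⁺ʳ zs (proj₂ (proj₂ detours)) ⟩
      cartesianProductWith column words (allFin (suc b)) ++ zs
        ↭⟨ ++⁺ʳ zs (cartesianProductWith-∷ʳ column words zero (tabulate suc)) ⟩
      (ls ++ cartesianProductWith column words (tabulate suc)) ++ zs
        ≡⟨ cong (λ js → (ls ++ cartesianProductWith column words js) ++ zs)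
                (map-tabulate (λ i → i) suc) ⟨
      (ls ++ cartesianProductWith column words (map suc (allFin b))) ++ zs
        ≡⟨ cong (λ js → (ls ++ js) ++ zs) (cartesianProductWith-mapʳ column suc words (allFin b)) ⟩
      (ls ++ hs) ++ zs
        ≡⟨ ++-assoc ls hs zs ⟩
      ls ++ hs ++ zs
        ↭⟨ ++⁺ˡ ls (++-comm hs zs) ⟩
      ls ++ zs ++ hs
        ≡⟨ ++-assoc ls zs hs ⟨
      (ls ++ zs) ++ hs
        ≡⟨ cong (λ xs → (xs ++ zs) ++ hs) (map-∘ words) ⟩
      (map (low zero) (map (low lastˡ) words) ++ zs) ++ hs
        ≡⟨ cong (_++ hs) (map-++ (low zero) (map (low lastˡ) words) rest) ⟨
      map (low zero) row₀ ++ hs ∎)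
      where
      open PermutationReasoning
      zs ls hs : List (Word (suc (suc m)))
      zs = map (low zero) rest
      ls = map (low zero ∘ low lastˡ) words
      hs = cartesianProductWith (flip high) words (allFin b)

    ∈-zero-row⁻ : ∀ {v} →
      v ∈ map (low zero) (final ∷ row₀) ++ cartesianProductWith (flip high) words (allFin b) →
      take 1 v ≡ low zero ε
    ∈-zero-row⁻ v∈ with ∈-++⁻ (map (low zero) (final ∷ row₀)) v∈
    ... | inj₁ v∈ˡ with _ , _ , refl ← ∈-map⁻ (low zero) v∈ˡ = refl
    ... | inj₂ v∈ʳ
      with _ , _ , _ , _ , refl ← ∈-cartesianProductWith⁻ (flip high) words (allFin b) v∈ʳ = refl

    -- Together with `∈-row⁺`, this identifies a row and its spine vertex with a fibre of `take k`,
    -- as `Enumerates-concatMap` requires.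
    ∈-row⁻ : ∀ {k} (u : Word k) {v} → v ∈ spine u ∷ row u → take k v ≡ u
    ∈-row⁻ {zero} ε _ = refl
    ∈-row⁻ {suc zero} (low zero ε) v∈ = ∈-zero-row⁻ (∈-resp-↭ zero-row-↭ v∈)
    ∈-row⁻ {suc zero} (low (suc i) ε) v∈
      with _ , _ , refl ← ∈-map⁻ (low (suc i)) {xs = final ∷ row₀} v∈ = refl
    ∈-row⁻ {suc (suc k)} (low i u) v∈
      with _ , w∈ , refl ← ∈-map⁻ (low i) {xs = spine u ∷ row u} v∈ = cong (low i) (∈-row⁻ u w∈)
    ∈-row⁻ {suc (suc k)} (high j u) v∈
      with _ , w∈ , refl ← ∈-map⁻ (high j) {xs = spine u ∷ row u} v∈ = cong (high j) (∈-row⁻ u w∈)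

    ∈-row⁺ : ∀ k (v : Word (k + suc m)) → v ∈ spine (take k v) ∷ row (take k v)
    ∈-row⁺ zero v = proj₂ enumerates⁺ v
    ∈-row⁺ (suc zero) (low zero w) =
      ∈-resp-↭ (↭-sym zero-row-↭) (∈-++⁺ˡ (∈-map⁺ (low zero) (proj₂ enumerates⁺ w)))
    ∈-row⁺ (suc zero) (low (suc i) w) = ∈-map⁺ (low (suc i)) (proj₂ enumerates⁺ w)
    ∈-row⁺ (suc zero) (high j w) =
      ∈-resp-↭ (↭-sym zero-row-↭) (∈-++⁺ʳ (map (low zero) (final ∷ row₀))
        (∈-cartesianProductWith⁺ (flip high) (proj₂ enumerates w) (∈-allFin j)))
    ∈-row⁺ (suc (suc k)) (low i w)  = ∈-map⁺ (low i) (∈-row⁺ (suc k) w)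
    ∈-row⁺ (suc (suc k)) (high j w) = ∈-map⁺ (high j) (∈-row⁺ k w)

    zero-row-unique : Unique (low zero final ∷ row₁ zero)
    zero-row-unique = Unique-resp-↭ (↭-sym zero-row-↭)
      (Unique.++⁺
        (Unique.map⁺ (proj₂ ∘ low-injective) (proj₁ enumerates⁺))
        (Unique.cartesianProductWith⁺ (flip high) (swap ∘ high-injective)
          (proj₁ enumerates) (Unique.allFin⁺ b))
        disjoint)
      where
      disjoint : ∀ {v} → ¬ (v ∈ map (low zero) (final ∷ row₀) ×
                            v ∈ cartesianProductWith (flip high) words (allFin b))
      disjoint (v∈ , v∈′)
        with _ , _ , refl ← ∈-map⁻ (low zero) v∈
        with _ , _ , _ , _ , () ← ∈-cartesianProductWith⁻ (flip high) words (allFin b) v∈′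

    row-unique : ∀ {k} (u : Word k) → Unique (spine u ∷ row u)
    row-unique {zero} ε = proj₁ enumerates⁺
    row-unique {suc zero} (low zero ε) = zero-row-unique
    row-unique {suc zero} (low (suc i) ε) =
      Unique.map⁺ (proj₂ ∘ low-injective) {final ∷ row₀} (proj₁ enumerates⁺)
    row-unique {suc (suc k)} (low i u) =
      Unique.map⁺ (proj₂ ∘ low-injective) {spine u ∷ row u} (row-unique u)
    row-unique {suc (suc k)} (high j u) =
      Unique.map⁺ (proj₂ ∘ high-injective) {spine u ∷ row u} (row-unique u)

    -- The rows are ordered along the path of `g`. Adjacent words give adjacent row ends and spine
    -- vertices by `append-congˡ`, and the edge from `penult` to `final` in the first row closes the
    -- cycle.
    hamCycle : ∀ {k} (g : HamPath k) →
      parity (length (map (low lastˡ) (HamPath.words g) ++ HamPath.rest g)) ≡ 0ℙ →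
      HamCycle (suc k + suc m)
    hamCycle g evenRows
      with vs , p , perm ← comb ~-sym
             (λ u → append u (low lastˡ start)) (λ u → append u penult) spine row
             (append-congˡ _) (append-congˡ _) (append-congˡ _)
             (λ u → append-congʳ u penult~final) row-path
             (HamPath.path⁺ g) evenRows
      = record
      { path       = p
      ; start~end  = append-congʳ _ penult~final
      ; enumerates = Enumerates-resp-↭ (↭-sym perm)
          (Enumerates-concatMap row-unique ∈-row⁻ (∈-row⁺ _) (HamPath.enumerates⁺ g))
      }

  -- The number of words and its parity.

  size : ℕ → ℕ
  size zero          = 1
  size (suc zero)    = a
  size (suc (suc n)) = a * size (suc n) + b * size n

  Enumerates-size : ∀ n {ws : List (Word n)} → Enumerates ws → length ws ≡ size n
  -- The prefix of `hamPath zero` lists the empty word alone.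
  Enumerates-size zero e =
    Enumerates-length e (Prefix.enumerates (HamPath.prefix (hamPath zero)))
  Enumerates-size (suc zero) {ws} e = begin
    length ws
      ≡⟨ Enumerates-length e (Enumerates-map (proj₁ ∘ low-injective)
           (λ { (low i ε) → i , refl }) (Enumerates-allFin a)) ⟩
    length (map (λ i → low i ε) (allFin a))  ≡⟨ length-map _ (allFin a) ⟩
    length (allFin a)                        ≡⟨ length-tabulate {n = a} (λ i → i) ⟩
    a                                        ∎
    where open ≡-Reasoning
  -- The recursion needs some enumerations of the shorter words; the prefixes of Hamiltonian paths
  -- provide them.
  Enumerates-size (suc (suc n)) {ws} e = begin
    length ws
      ≡⟨ Enumerates-length e
           (Enumerates-suc-suc (Enumerates-allFin a) (Enumerates-allFin b) eᵘ eᵛ) ⟩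
    length (cartesianProductWith low (allFin a) us ++ cartesianProductWith high (allFin b) vs)
      ≡⟨ length-++ (cartesianProductWith low (allFin a) us) ⟩
    length (cartesianProductWith low (allFin a) us) +
    length (cartesianProductWith high (allFin b) vs)
      ≡⟨ cong₂ _+_ (length-cartesianProductWith low (allFin a) us)
                   (length-cartesianProductWith high (allFin b) vs) ⟩
    length (allFin a) * length us + length (allFin b) * length vs
      ≡⟨ cong₂ _+_ (cong₂ _*_ (length-tabulate {n = a} (λ i → i)) (Enumerates-size (suc n) eᵘ))
                   (cong₂ _*_ (length-tabulate {n = b} (λ i → i)) (Enumerates-size n eᵛ)) ⟩
    a * size (suc n) + b * size n ∎
    where
    open ≡-Reasoning
    open Prefix (HamPath.prefix (hamPath (suc n))) renaming (words to us; enumerates to eᵘ)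
    open Prefix (HamPath.prefix (hamPath n)) renaming (words to vs; enumerates to eᵛ)

  parity-size : ∀ n → parity (size n) ≡ horadamℙ (parity a) (parity b) n
  parity-size zero          = refl
  parity-size (suc zero)    = refl
  parity-size (suc (suc n)) =
    trans (+-homo-+ (a * size (suc n)) (b * size n))
      (cong₂ ℙ._+_
        (trans (*-homo-* a (size (suc n))) (cong (parity a ℙ.*_) (parity-size (suc n))))
        (trans (*-homo-* b (size n)) (cong (parity b ℙ.*_) (parity-size n))))

  parity-length : ∀ n {ws : List (Word n)} → Enumerates ws →
                  parity (length ws) ≡ horadamℙ (parity a) (parity b) n
  parity-length n e = trans (cong parity (Enumerates-size n e)) (parity-size n)

  size≥1 : ∀ n → 1 ≤ size n
  size≥1 zero          = s≤s z≤n
  size≥1 (suc zero)    = s≤s z≤n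
  size≥1 (suc (suc n)) = ≤-trans (size≥1 (suc n)) (≤-trans (m≤m+n _ _) (m≤m+n _ _))

  size-grows : ∀ n → 1 + size (suc n) ≤ size (suc (suc n))
  size-grows n = ≤-trans (≤-reflexive (+-comm 1 _))
    (+-mono-≤ (m≤m+n (size (suc n)) _) (≤-trans (size≥1 n) (m≤m+n _ _)))

  evenCycle : ∀ n → horadamℙ (parity a) (parity b) (suc (suc (suc n))) ≡ 0ℙ →
              HamCycle (suc (suc (suc n)))
  evenCycle n even with horadamℙ-even (parity a) (parity b) n even
  evenCycle n even | inj₁ (even₁ , even₂) =
    Rows.hamCycle h (trans (parity-length (suc n) (HamPath⁻.enumerates h)) even₂)
      (hamPath 0) (trans (parity-length 1 (HamPath.enumerates⁺ (hamPath 0))) even₁)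
    where h = extend (hamPath n)
  -- The case `zero` cannot occur, since there is exactly one empty word and `even₂` would make that
  -- number even.
  evenCycle (suc n) even | inj₂ (even₁ , even₂) =
    Rows.hamCycle h (trans (parity-length (suc n) (HamPath⁻.enumerates h)) even₂)
      (hamPath 1) (trans (parity-length 2 (HamPath.enumerates⁺ (hamPath 1))) even₁)
    where h = extend (hamPath n)

  -- Words and admissible strings.

  low-admissible : ∀ {n} {x} {xs : Vec (Fin (a + b)) n} →
                   toℕ x < a → Admissible a b xs → Admissible a b (x ∷ xs)
  low-admissible x<a adm zero    a≤x = contradiction a≤x (<⇒≱ x<a)
  low-admissible x<a adm (suc i) a≤y =
    let j , eq , zero-j = adm i a≤y in suc j , cong suc eq , zero-j

  high-admissible : ∀ {n} {y} {xs : Vec (Fin (a + b)) n} →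
                    Admissible a b xs → Admissible a b (zero ∷ y ∷ xs)
  high-admissible adm zero          ()
  high-admissible adm (suc zero)    a≤y = zero , refl , refl
  high-admissible adm (suc (suc i)) a≤z =
    let j , eq , zero-j = adm i a≤z in suc (suc j) , cong (2 +_) eq , zero-j

  low<a : ∀ i → toℕ (i ↑ˡ b) < a
  low<a i = subst (_< a) (sym (toℕ-↑ˡ i b)) (toℕ<n i)

  high≥a : ∀ (j : Fin b) → a ≤ toℕ (a ↑ʳ j)
  high≥a j = subst (a ≤_) (sym (toℕ-↑ʳ a j)) (m≤m+n a (toℕ j))

  low≢high : ∀ {i} {j : Fin b} → ¬ (i ↑ˡ b ≡ a ↑ʳ j)
  low≢high {i} {j} eq = <⇒≱ (low<a i) (subst (λ x → a ≤ toℕ x) (sym eq) (high≥a j))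

  letters-admissible : ∀ {n} (w : Word n) → Admissible a b (letters w)
  letters-admissible ε          ()
  letters-admissible (low i w)  = low-admissible (low<a i) (letters-admissible w)
  letters-admissible (high j w) = high-admissible (letters-admissible w)

  -- The second letter decides the kind of the first block: it is at least a after a `high` start,
  -- and below a when a `low` block is followed by another block.
  letters-injective : ∀ {n} {u v : Word n} → letters u ≡ letters v → u ≡ v
  letters-injective {u = ε}       {ε}       _  = refl
  letters-injective {u = low i u} {low j v} eq =
    cong₂ low (↑ˡ-injective b i j (∷-injectiveˡ eq)) (letters-injective (∷-injectiveʳ eq))
  letters-injective {u = high i u} {high j v} eq =
    cong₂ high (↑ʳ-injective a i j (∷-injectiveˡ (∷-injectiveʳ eq)))
               (letters-injective (∷-injectiveʳ (∷-injectiveʳ eq)))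
  letters-injective {u = low i (low _ _)}  {high j v} eq =
    contradiction (∷-injectiveˡ (∷-injectiveʳ eq)) low≢high
  letters-injective {u = low i (high _ _)} {high j v} eq with () ← ∷-injectiveˡ (∷-injectiveʳ eq)
  letters-injective {u = high j v} {low i (low _ _)}  eq =
    contradiction (sym (∷-injectiveˡ (∷-injectiveʳ eq))) low≢high
  letters-injective {u = high j v} {low i (high _ _)} eq with () ← ∷-injectiveˡ (∷-injectiveʳ eq)

  tail-admissible : ∀ {n x y} {xs : Vec (Fin (a + b)) n} →
                    toℕ y < a → Admissible a b (x ∷ y ∷ xs) → Admissible a b (y ∷ xs)
  tail-admissible y<a adm zero    a≤y = contradiction a≤y (<⇒≱ y<a)
  tail-admissible y<a adm (suc i) a≤z with adm (suc (suc i)) a≤z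
  ... | suc j , eq , zero-j = j , suc-injective eq , zero-j

  tail²-admissible : ∀ {n x y} {xs : Vec (Fin (a + b)) n} →
                     a ≤ toℕ y → Admissible a b (x ∷ y ∷ xs) → Admissible a b xs
  tail²-admissible a≤y adm i a≤z with adm (suc (suc i)) a≤z
  -- Here the required letter 0 would have to be `y`, which is at least a.
  ... | suc zero    , eq , zero-y = contradiction (subst (a ≤_) zero-y a≤y) λ ()
  ... | suc (suc j) , eq , zero-j = j , suc-injective (suc-injective eq) , zero-j

  high-head-inadmissible : ∀ {n x} {xs : Vec (Fin (a + b)) n} →
                           a ≤ toℕ x → ¬ Admissible a b (x ∷ xs)
  high-head-inadmissible a≤x adm with _ , () , _ ← adm zero a≤x

  high-after-nonzero-inadmissible : ∀ {n x y} {xs : Vec (Fin (a + b)) n} →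
                                    a ≤ toℕ y → ¬ Admissible a b (suc x ∷ y ∷ xs)
  high-after-nonzero-inadmissible a≤y adm with adm (suc zero) a≤y
  ... | zero , _ , ()

  splitAt-low : ∀ {x i} → splitAt a {b} x ≡ inj₁ i → toℕ x < a
  splitAt-low {i = i} eq = subst (λ y → toℕ y < a) (splitAt⁻¹-↑ˡ eq) (low<a i)

  splitAt-high : ∀ {x j} → splitAt a {b} x ≡ inj₂ j → a ≤ toℕ x
  splitAt-high {j = j} eq = subst (λ y → a ≤ toℕ y) (splitAt⁻¹-↑ʳ eq) (high≥a j)

  -- A vertex carries its admissibility proof irrelevantly, so no word can be computed from that
  -- proof. The word is found from the letters alone, and the proof only refutes the second
  -- alternative.
  parse : ∀ {n} (xs : Vec (Fin (a + b)) n) → (∃[ w ] letters w ≡ xs) ⊎ ¬ Admissible a b xs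
  parse []       = inj₁ (ε , refl)
  parse (x ∷ []) with splitAt a x in eq
  ... | inj₁ i = inj₁ (low i ε , cong (_∷ []) (splitAt⁻¹-↑ˡ eq))
  ... | inj₂ j = inj₂ (high-head-inadmissible (splitAt-high eq))
  parse (x ∷ y ∷ xs) with splitAt a x in eq | splitAt a y in eq′ | parse (y ∷ xs) | parse xs
  ... | inj₂ _ | _ | _ | _ = inj₂ (high-head-inadmissible (splitAt-high eq))
  ... | inj₁ i | inj₁ _ | inj₁ (w , eq″) | _ = inj₁ (low i w , cong₂ _∷_ (splitAt⁻¹-↑ˡ eq) eq″)
  ... | inj₁ _ | inj₁ _ | inj₂ ¬adm | _ = inj₂ (¬adm ∘ tail-admissible (splitAt-low eq′))
  parse (suc _ ∷ _) | inj₁ _ | inj₂ _ | _ | _ =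
    inj₂ (high-after-nonzero-inadmissible (splitAt-high eq′))
  parse (zero ∷ _) | inj₁ _ | inj₂ j | _ | inj₁ (w , eq″) =
    inj₁ (high j w , cong (zero ∷_) (cong₂ _∷_ (splitAt⁻¹-↑ʳ eq′) eq″))
  parse (zero ∷ _) | inj₁ _ | inj₂ _ | _ | inj₂ ¬adm =
    inj₂ (¬adm ∘ tail²-admissible (splitAt-high eq′))

  vertex : ∀ {n} → Word n → 𝓢 a b n
  vertex w = letters w , Irr.[ letters-admissible w ]

  vertex-injective : ∀ {n} {u v : Word n} → vertex u ≡ vertex v → u ≡ v
  vertex-injective = letters-injective ∘ cong value

  vertex-surjective : ∀ {n} (s : 𝓢 a b n) → ∃[ w ] vertex w ≡ s
  vertex-surjective (xs , Irr.[ adm ]) with parse xs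
  ... | inj₁ (w , eq) = w , value-injective eq
  ... | inj₂ ¬adm     = ⊥-elim-irr (¬adm adm)

  Path-vertex : ∀ {n} {u v : Word n} {ws} → Path _~_ u v ws →
                Path (SimpleGraph._~_ (Π a b n)) (vertex u) (vertex v) (map vertex ws)
  Path-vertex = Path-map vertex _~_.dist≡1

  Enumerates-vertex : ∀ {n} {ws : List (Word n)} → Enumerates ws → Enumerates (map vertex ws)
  Enumerates-vertex = Enumerates-map vertex-injective vertex-surjective

  -- Transfer to the Horadam cube.

  hasHamiltonianPath : ∀ n → HasHamiltonianPath (Π a b (suc n))
  hasHamiltonianPath n = Path⇒HasHamiltonianPath (Π a b (suc n))
    (Path-vertex path⁺) (Enumerates-vertex enumerates⁺)
    where open HamPath (hamPath n)

  -- The bijection carries an enumeration of the words to one of `Fin m`, so their lengths agree.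
  card-even : ∀ {m n} → 𝓢 a b (suc n) ↔ Fin m → 2 ∣ m →
              horadamℙ (parity a) (parity b) (suc n) ≡ 0ℙ
  card-even {m} {n} iso 2∣m = begin
    horadamℙ (parity a) (parity b) (suc n)  ≡⟨ parity-length (suc n) enumerates⁺ ⟨
    parity (length ws)                      ≡⟨ cong parity card ⟩
    parity m                                ≡⟨ 2∣⇒parity≡0ℙ 2∣m ⟩
    0ℙ                                      ∎
    where
    open ≡-Reasoning
    open HamPath (hamPath n)
    ws = map (low lastˡ) words ++ rest
    card : length ws ≡ m
    card = begin
      length ws ≡⟨ length-map (Inverse.to iso ∘ vertex) ws ⟨
      length (map (Inverse.to iso ∘ vertex) ws)
        ≡⟨ Enumerates-length
             (Enumerates-map (vertex-injective ∘ Injection.injective (↔⇒↣ iso))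
               (λ i → let w , eq = vertex-surjective (Inverse.from iso i)
                      in w , Inverse.inverseˡ iso eq)
               enumerates⁺)
             (Enumerates-allFin m) ⟩
      length (allFin m) ≡⟨ length-tabulate {n = m} (λ i → i) ⟩
      m ∎

  isHamiltonian : ∀ {m} n → 𝓢 a b (3 + n) ↔ Fin m → 2 ∣ m → IsHamiltonian (Π a b (3 + n))
  isHamiltonian n iso 2∣m = Path⇒IsHamiltonian (Π a b (3 + n))
    (Path-vertex path) (_~_.dist≡1 start~end) (Enumerates-vertex enumerates)
    (subst (3 ≤_) (sym (trans (length-map vertex words) (Enumerates-size (3 + n) enumerates)))
      -- A size of at least one at length n + 1 grows strictly twice, which gives at least three
      -- vertices.
      (≤-trans (s≤s (≤-trans (s≤s (size≥1 (suc n))) (size-grows n))) (size-grows (suc n))))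
    where open HamCycle (evenCycle n (card-even iso 2∣m))

corollary3 : ∀ (a b n : ℕ) → 1 ≤ a → 1 ≤ b → 1 ≤ n →
    HasHamiltonianPath (Π a b n) ×
    (2 < n → ∀ (m : ℕ) → SimpleGraph.Vertex (Π a b n) ↔ Fin m → 2 ∣ m →
    IsHamiltonian (Π a b n))
corollary3 (suc a) (suc b) (suc n) _ _ _ = hasHamiltonianPath n , cycle n
  where
  open Horadam a b using (hasHamiltonianPath; isHamiltonian)
  cycle : ∀ n → 2 < suc n → ∀ m → 𝓢 (suc a) (suc b) (suc n) ↔ Fin m → 2 ∣ m →
          IsHamiltonian (Π (suc a) (suc b) (suc n))
  cycle zero          (s≤s ())
  cycle (suc zero)    (s≤s (s≤s ()))
  cycle (suc (suc n)) _ m = isHamiltonian n
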